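{- Let $D_1$ and $D_2$ be digraphs such that the underlying graph of $D_2$ is $4$-colorable. Then there is a homomorphism $D_1\to D_2$ if and only if there is a homomorphism $G[D_1]\to G[D_2]$. Furthermore, for any homomorphism $\psi:G[D_1]\to G[D_2]$, the restriction of $\psi$ to the vertices of $D_1$ is a homomorphism of $D_1$ to $D_2$.
   Context: All digraphs and graphs are finite, without loops and without parallel arcs/edges; digons (pairs of opposite arcs) are allowed in digraphs. A homomorphism of (di)graphs is a vertex map sending edges to edges (arcs to arcs, preserving direction). The graph $K_2\vee C_5$ is the complete join of $K_2$ and the $5$-cycle $C_5$: the disjoint union of $K_2$ and $C_5$ together with all edges between them. Given a digraph $D$, the (undirected) graph $G[D]$ is built by replacing each arc $u\to v$ of $D$ with its own (vertex-disjoint) copy of the gadget $K_2\vee C_5$, where the head $v$ is identified with a vertex of the $K_2$ part and the tail $u$ is identified with a vertex of the $C_5$ part; thus $V(D)\subseteq V(G[D])$, and copies corresponding to distinct arcs share only vertices of $D$.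
   Formalization: ψ may move sources, sinks or isolated vertices of D₁ off V(D₂), so the last claim is proved as: ψ restricted to V(D₁) is a homomorphism if it lands in V(D₂); vertices with in- and out-arcs do land there; always a homomorphism after moving private gadget vertices to the arc's end in the same part. -}

module Defs where

open import Data.Bool using (Bool; T)
open import Data.Fin using (Fin; zero; suc; toℕ)
open import Data.Nat using (ℕ; suc)
open import Data.Nat.DivMod using (_%_)
open import Data.Product using (Σ; ∃)
open import Data.Sum using (_⊎_; inj₁; inj₂; swap)
open import Data.Unit using (⊤; tt)
open import Relation.Binary.Core using (Rel)
open import Relation.Binary.Definitions using (Symmetric)
open import Relation.Binary.PropositionalEquality
  using (_≡_; _≢_; refl; sym; subst)
open import Relation.Nullary using (¬_)
open import Level using (0ℓ)

-- Simple graphs.  Finiteness is not a field: every graph below is built from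
-- finite data (a digraph on Fin n, or an explicit small graph).
record Graph : Set₁ where
  field
    Vertex  : Set
    Adj     : Rel Vertex 0ℓ
    adj-sym : Symmetric Adj
    no-loop : ∀ {x} → ¬ Adj x x

-- The Boolean adjacency matrix makes arcs decidable and excludes parallel
-- arcs; digons are allowed.
record Digraph : Set where
  field
    order    : ℕ
    arc      : Fin order → Fin order → Bool
    loopless : ∀ v → ¬ T (arc v v)

  Vertex : Set
  Vertex = Fin order

  _⟶_ : Rel Vertex 0ℓ
  u ⟶ v = T (arc u v)

  HasInArc HasOutArc : Vertex → Set
  HasInArc  v = ∃ λ u → u ⟶ v
  HasOutArc v = ∃ λ w → v ⟶ w

  record Arc : Set where
    constructor mkArc
    field
      {tail} {head} : Vertex
      isArc         : tail ⟶ head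

IsGraphHom : (G H : Graph) → (Graph.Vertex G → Graph.Vertex H) → Set
IsGraphHom G H f = ∀ {x y} → Graph.Adj G x y → Graph.Adj H (f x) (f y)

GraphHom : Graph → Graph → Set
GraphHom G H = Σ (Graph.Vertex G → Graph.Vertex H) (IsGraphHom G H)

IsDigraphHom : (D E : Digraph) → (Digraph.Vertex D → Digraph.Vertex E) → Set
IsDigraphHom D E f = ∀ {u v} → u D.⟶ v → f u E.⟶ f v
  where
  module D = Digraph D
  module E = Digraph E

DigraphHom : Digraph → Digraph → Set
DigraphHom D E = Σ (Digraph.Vertex D → Digraph.Vertex E) (IsDigraphHom D E)

underlying : Digraph → Graph
underlying D = record
  { Vertex  = Vertex
  ; Adj     = λ u v → u ⟶ v ⊎ v ⟶ u
  ; adj-sym = swap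
  ; no-loop = λ { (inj₁ a) → loopless _ a ; (inj₂ a) → loopless _ a }
  }
  where open Digraph D

Colorable : ℕ → Graph → Set
Colorable k G = Σ (Vertex → Fin k) λ c → ∀ {x y} → Adj x y → c x ≢ c y
  where open Graph G

K : ℕ → Graph
K n = record
  { Vertex  = Fin n
  ; Adj     = _≢_
  ; adj-sym = λ x≢y y≡x → x≢y (sym y≡x)
  ; no-loop = λ x≢x → x≢x refl
  }

C₅ : Graph
C₅ = record
  { Vertex  = Fin 5
  ; Adj     = λ i j → Next i j ⊎ Next j i
  ; adj-sym = swap
  ; no-loop = λ { {i} (inj₁ p) → next-irrefl i p ; {i} (inj₂ p) → next-irrefl i p }
  }
  where
  Next : Rel (Fin 5) 0ℓ
  Next i j = toℕ j ≡ suc (toℕ i) % 5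

  next-irrefl : ∀ i → ¬ Next i i
  next-irrefl zero                         ()
  next-irrefl (suc zero)                   ()
  next-irrefl (suc (suc zero))             ()
  next-irrefl (suc (suc (suc zero)))       ()
  next-irrefl (suc (suc (suc (suc zero)))) ()

_∨_ : Graph → Graph → Graph
G ∨ H = record
  { Vertex  = G.Vertex ⊎ H.Vertex
  ; Adj     = JoinAdj
  ; adj-sym = λ {x} {y} → join-sym x y
  ; no-loop = λ {x} → join-irrefl x
  }
  where
  module G = Graph G
  module H = Graph H

  JoinAdj : Rel (G.Vertex ⊎ H.Vertex) 0ℓ
  JoinAdj (inj₁ x) (inj₁ y) = G.Adj x y
  JoinAdj (inj₁ _) (inj₂ _) = ⊤
  JoinAdj (inj₂ _) (inj₁ _) = ⊤
  JoinAdj (inj₂ x) (inj₂ y) = H.Adj x y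

  join-sym : ∀ x y → JoinAdj x y → JoinAdj y x
  join-sym (inj₁ _) (inj₁ _) a = G.adj-sym a
  join-sym (inj₁ _) (inj₂ _) _ = tt
  join-sym (inj₂ _) (inj₁ _) _ = tt
  join-sym (inj₂ _) (inj₂ _) a = H.adj-sym a

  join-irrefl : ∀ x → ¬ JoinAdj x x
  join-irrefl (inj₁ _) = G.no-loop
  join-irrefl (inj₂ _) = H.no-loop

Gadget : Graph
Gadget = K 2 ∨ C₅

module GadgetReplacement (D : Digraph) where
  open Digraph D

  -- Once two of its seven vertices are identified with the ends of the arc, a
  -- copy of the gadget has five private vertices: the other vertex of K₂ (apex)
  -- and the other four vertices of C₅ (rim).
  data GVertex : Set where
    base : Vertex → GVertex
    apex : Arc → GVertex
    rim  : Arc → Fin 4 → GVertex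

  copy : Arc → Graph.Vertex Gadget → GVertex
  copy a (inj₁ zero)       = base (Arc.head a)
  copy a (inj₁ (suc zero)) = apex a
  copy a (inj₂ zero)       = base (Arc.tail a)
  copy a (inj₂ (suc i))    = rim a i

  data GAdj : Rel GVertex 0ℓ where
    edge : ∀ a {p q} → Graph.Adj Gadget p q → GAdj (copy a p) (copy a q)

  -- The identity on V(D); a private gadget vertex goes to the vertex of D that
  -- lies in the same part (K₂ or C₅) of its copy.  Automorphisms of the gadget
  -- can move a source or a sink of D off V(D), so a homomorphism
  -- G[ D₁ ] → G[ D₂ ] need not map V(D₁) into V(D₂); composing with collapse
  -- corrects this and changes nothing at vertices already mapped into V(D₂).
  collapse : GVertex → Vertex
  collapse (base v)  = v
  collapse (apex a)  = Arc.head a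
  collapse (rim a _) = Arc.tail a

  private
    copy-injective : ∀ a p q → copy a p ≡ copy a q → p ≡ q
    copy-injective a (inj₁ zero)       (inj₁ zero)       _    = refl
    copy-injective a (inj₁ zero)       (inj₁ (suc zero)) ()
    copy-injective (mkArc a) (inj₁ zero) (inj₂ zero)     refl with () ← loopless _ a
    copy-injective a (inj₁ zero)       (inj₂ (suc _))    ()
    copy-injective a (inj₁ (suc zero)) (inj₁ zero)       ()
    copy-injective a (inj₁ (suc zero)) (inj₁ (suc zero)) _    = refl
    copy-injective a (inj₁ (suc zero)) (inj₂ zero)       ()
    copy-injective a (inj₁ (suc zero)) (inj₂ (suc _))    ()
    copy-injective (mkArc a) (inj₂ zero) (inj₁ zero)     refl with () ← loopless _ a
    copy-injective a (inj₂ zero)       (inj₁ (suc zero)) ()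
    copy-injective a (inj₂ zero)       (inj₂ zero)       _    = refl
    copy-injective a (inj₂ zero)       (inj₂ (suc _))    ()
    copy-injective a (inj₂ (suc _))    (inj₁ zero)       ()
    copy-injective a (inj₂ (suc _))    (inj₁ (suc zero)) ()
    copy-injective a (inj₂ (suc _))    (inj₂ zero)       ()
    copy-injective a (inj₂ (suc _))    (inj₂ (suc _))    refl = refl

    GAdj-irrefl : ∀ {x y} → GAdj x y → x ≢ y
    GAdj-irrefl (edge a {p} {q} e) eq =
      Graph.no-loop Gadget {q}
        (subst (λ r → Graph.Adj Gadget r q) (copy-injective a p q eq) e)

  graph : Graph
  graph = record
    { Vertex  = GVertex
    ; Adj     = GAdj
    ; adj-sym = λ { (edge a {p} {q} e) → edge a {q} {p} (Graph.adj-sym Gadget {p} {q} e) }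
    ; no-loop = λ e → GAdj-irrefl e refl
    }

open GadgetReplacement public using (base; collapse)

G[_] : Digraph → Graph
G[ D ] = GadgetReplacement.graph D

{-# OPTIONS --safe #-}

-- The gadget K₂ ∨ C₅ is not 4-colourable, whereas deleting one private rim
-- vertex from every copy makes G[ D ] 4-colourable as soon as D is: a colouring
-- of D extends to each punctured copy.  If a homomorphism from the gadget to
-- G[ D ] sent a vertex y of K₂ into the C₅ part of a copy, at position j say, then
-- the whole image, which lies in the closed neighbourhood of y and of the other
-- vertex of K₂, would miss the rim vertices at a position not adjacent to j, in
-- all copies.  So K₂ goes to the K₂ part of a copy and C₅ to the C₅ part of the
-- same copy, and collapse sends the ends of an arc to the ends of an arc.
module Submission where

open import Defs
open import Data.Fin using (Fin; zero; suc; toℕ; punchIn; punchOut)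
open import Data.Fin.Patterns using (0F; 1F; 2F; 3F; 4F)
open import Data.Fin.Properties
  using (_≟_; all?; any?; punchIn-injective; punchInᵢ≢i; punchIn-punchOut; punchOut-injective)
import Data.Nat as ℕ
open import Data.Nat.DivMod using (_%_)
open import Data.Product using (_×_; _,_; ∃; ∃-syntax; proj₁; proj₂)
open import Data.Sum using (_⊎_; inj₁; inj₂)
open import Data.Unit using (tt)
open import Function using (_∘_)
open import Function.Bundles using (_⇔_; mk⇔)
open import Function.Definitions using (Injective)
open import Relation.Binary.Definitions using (Decidable)
open import Relation.Binary.PropositionalEquality
  using (_≡_; _≢_; refl; sym; trans; cong; subst; subst₂)
open import Relation.Nullary using (¬_; ¬?; contradiction)
open import Relation.Nullary.Decidable using (from-yes; _×-dec_; _⊎-dec_; _→-dec_)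

-- Colour obstruction in the gadget

private
  module C₅ = Graph C₅
  module Gadget = Graph Gadget

C₅-adj? : Decidable C₅.Adj
C₅-adj? i j = (toℕ j ℕ.≟ ℕ.suc (toℕ i) % 5) ⊎-dec (toℕ i ℕ.≟ ℕ.suc (toℕ j) % 5)

-- With only two colours, vertices at distance two along a path agree, so 0, 2 and 4 share a colour
-- although 4 and 0 are adjacent.
C₅-not-2-colorable : ¬ Colorable 2 C₅
C₅-not-2-colorable (c , proper) =
  proper {4F} {0F} (inj₁ refl)
    (sym (trans (alternate (proper {0F} {1F} (inj₁ refl)) (proper {1F} {2F} (inj₁ refl)))
                (alternate (proper {2F} {3F} (inj₁ refl)) (proper {3F} {4F} (inj₁ refl)))))
  where
  alternate : {x y z : Fin 2} → x ≢ y → y ≢ z → x ≡ z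
  alternate {0F} {_}  {0F} _ _ = refl
  alternate {1F} {_}  {1F} _ _ = refl
  alternate {0F} {0F} {1F} p _ = contradiction refl p
  alternate {0F} {1F} {1F} _ q = contradiction refl q
  alternate {1F} {0F} {0F} _ q = contradiction refl q
  alternate {1F} {1F} {0F} p _ = contradiction refl p

-- The two vertices of K₂ have distinct colours, and neither colour occurs on `H`. Each `punchOut`
-- deletes one of them and renumbers the rest.
uncone₂ : ∀ {n H} → Colorable (ℕ.suc (ℕ.suc n)) (K 2 ∨ H) → Colorable n H
uncone₂ {n} {H} (c , proper) = colour , λ {i} {j} e eq →
  proper {inj₂ i} {inj₂ j} e
    (punchOut-injective (x≢ i) (x≢ j) (punchOut-injective (y≢ i) (y≢ j) eq))
  where
  x≢y : c (inj₁ 0F) ≢ c (inj₁ 1F)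
  x≢y = proper {inj₁ 0F} {inj₁ 1F} λ ()

  x≢ : ∀ i → c (inj₁ 0F) ≢ c (inj₂ i)
  x≢ i = proper {inj₁ 0F} {inj₂ i} tt

  y≢ : ∀ i → punchOut x≢y ≢ punchOut (x≢ i)
  y≢ i = proper {inj₁ 1F} {inj₂ i} tt ∘ punchOut-injective x≢y (x≢ i)

  colour : Graph.Vertex H → Fin n
  colour i = punchOut (y≢ i)

Gadget-not-4-colorable : ¬ Colorable 4 Gadget
Gadget-not-4-colorable = C₅-not-2-colorable ∘ uncone₂ {H = C₅}

-- Colouring the punctured gadget

-- A renaming of colours that carries one fixed colouring of the gadget, with 0 at the head and 1 at
-- the tail, to any prescribed pair of distinct colours at these ends. The double `punchIn`
-- enumerates the colours other than `h` and `t`.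
palette : ∀ {n} {h t : Fin (ℕ.suc (ℕ.suc n))} → h ≢ t →
          Fin (ℕ.suc (ℕ.suc n)) → Fin (ℕ.suc (ℕ.suc n))
palette {h = h} _   0F            = h
palette {t = t} _   1F            = t
palette {h = h} h≢t (suc (suc k)) = punchIn h (punchIn (punchOut h≢t) k)

palette-injective : ∀ {n} {h t : Fin (ℕ.suc (ℕ.suc n))} (h≢t : h ≢ t) →
                    Injective _≡_ _≡_ (palette h≢t)
palette-injective {h = h} {t} h≢t = injective _ _
  where
  spare≢h : ∀ k → punchIn h (punchIn (punchOut h≢t) k) ≢ h
  spare≢h k = punchInᵢ≢i h _

  spare≢t : ∀ k → punchIn h (punchIn (punchOut h≢t) k) ≢ t
  spare≢t k eq = punchInᵢ≢i (punchOut h≢t) k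
    (punchIn-injective h _ _ (trans eq (sym (punchIn-punchOut h≢t))))

  injective : ∀ x y → palette h≢t x ≡ palette h≢t y → x ≡ y
  injective 0F            0F            _  = refl
  injective 0F            1F            eq = contradiction eq h≢t
  injective 0F            (suc (suc l)) eq = contradiction (sym eq) (spare≢h l)
  injective 1F            0F            eq = contradiction (sym eq) h≢t
  injective 1F            1F            _  = refl
  injective 1F            (suc (suc l)) eq = contradiction (sym eq) (spare≢t l)
  injective (suc (suc k)) 0F            eq = contradiction eq (spare≢h k)
  injective (suc (suc k)) 1F            eq = contradiction eq (spare≢t k)
  injective (suc (suc k)) (suc (suc l)) eq =
    cong (λ z → suc (suc z)) (punchIn-injective _ k l (punchIn-injective h _ _ eq))

-- Vertex suc m of C₅ is the one left out: the other four form a path, which is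
-- coloured alternately with 1 and 3 so that vertex 0 (the tail) has colour 1.
cycleColour : Fin 4 → Fin 5 → Fin 4
cycleColour _  0F = 1F
cycleColour _  1F = 3F
cycleColour 0F 2F = 3F
cycleColour _  2F = 1F
cycleColour 3F 3F = 3F
cycleColour _  3F = 1F
cycleColour _  4F = 3F

gadgetColour : Fin 4 → Gadget.Vertex → Fin 4
gadgetColour _ (inj₁ 0F) = 0F
gadgetColour _ (inj₁ 1F) = 2F
gadgetColour m (inj₂ i)  = cycleColour m i

cycleColour-avoids : ∀ m i → cycleColour m i ≢ 0F × cycleColour m i ≢ 2F
cycleColour-avoids = from-yes (all? λ m → all? λ i →
  ¬? (cycleColour m i ≟ 0F) ×-dec ¬? (cycleColour m i ≟ 2F))

cycleColour-proper : ∀ m i j → C₅.Adj i j → i ≢ suc m → j ≢ suc m →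
                     cycleColour m i ≢ cycleColour m j
cycleColour-proper = from-yes (all? λ m → all? λ i → all? λ j →
  C₅-adj? i j →-dec (¬? (i ≟ suc m) →-dec (¬? (j ≟ suc m) →-dec
    ¬? (cycleColour m i ≟ cycleColour m j))))

gadgetColour-proper : ∀ m p q → Gadget.Adj p q → p ≢ inj₂ (suc m) → q ≢ inj₂ (suc m) →
                      gadgetColour m p ≢ gadgetColour m q
gadgetColour-proper m (inj₁ 0F) (inj₁ 0F) e _ _ _  = e refl
gadgetColour-proper m (inj₁ 0F) (inj₁ 1F) _ _ _ ()
gadgetColour-proper m (inj₁ 1F) (inj₁ 0F) _ _ _ ()
gadgetColour-proper m (inj₁ 1F) (inj₁ 1F) e _ _ _  = e refl
gadgetColour-proper m (inj₁ 0F) (inj₂ j)  _ _ _ eq = proj₁ (cycleColour-avoids m j) (sym eq)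
gadgetColour-proper m (inj₁ 1F) (inj₂ j)  _ _ _ eq = proj₂ (cycleColour-avoids m j) (sym eq)
gadgetColour-proper m (inj₂ i)  (inj₁ 0F) _ _ _ eq = proj₁ (cycleColour-avoids m i) eq
gadgetColour-proper m (inj₂ i)  (inj₁ 1F) _ _ _ eq = proj₂ (cycleColour-avoids m i) eq
gadgetColour-proper m (inj₂ i)  (inj₂ j)  e i≢ j≢  =
  cycleColour-proper m i j e (i≢ ∘ cong inj₂) (j≢ ∘ cong inj₂)

-- A vertex of C₅ has two non-neighbours besides itself, and at most one of them is 0, so some
-- private rim position qualifies.
C₅-nonneighbour : ∀ j → ∃[ m ] (suc m ≢ j × ¬ C₅.Adj (suc m) j)
C₅-nonneighbour = from-yes (all? λ j → any? {n = 4} λ m →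
  ¬? (suc m ≟ j) ×-dec ¬? (C₅-adj? (suc m) j))

-- Adjacency at private vertices

module _ (D : Digraph) where
  open Digraph D
  open GadgetReplacement D hiding (base; collapse)
  private module G = Graph graph

  tail≢head : (a : Arc) → Arc.tail a ≢ Arc.head a
  tail≢head a eq = loopless _ (subst (_⟶ Arc.head a) eq (Arc.isArc a))

  -- Private vertices have all their edges in their own copy. The equation on `x` is a separate
  -- hypothesis because the indices of `edge` are values of the function `copy`.
  rim-neighbour : ∀ {b i x z} → GAdj x z → x ≡ rim b i →
                  ∃[ q ] (z ≡ copy b q × Gadget.Adj (inj₂ (suc i)) q)
  rim-neighbour (edge a {inj₂ (suc _)} {q} e) refl = q , refl , e
  rim-neighbour (edge a {inj₁ 0F} e) ()
  rim-neighbour (edge a {inj₁ 1F} e) ()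
  rim-neighbour (edge a {inj₂ 0F} e) ()

  apex-neighbour : ∀ {b x z} → GAdj x z → x ≡ apex b →
                   ∃[ q ] (z ≡ copy b q × Gadget.Adj (inj₁ 1F) q)
  apex-neighbour (edge a {inj₁ 1F} {q} e) refl = q , refl , e
  apex-neighbour (edge a {inj₁ 0F} e) ()
  apex-neighbour (edge a {inj₂ 0F} e) ()
  apex-neighbour (edge a {inj₂ (suc _)} e) ()

  copy≡rim : ∀ {a b i} p → copy a p ≡ rim b i → p ≡ inj₂ (suc i)
  copy≡rim (inj₂ (suc _)) refl = refl
  copy≡rim (inj₁ 0F) ()
  copy≡rim (inj₁ 1F) ()
  copy≡rim (inj₂ 0F) ()

  -- A rim vertex adjacent to both ends of the edge would place both in its own copy `b`. The end at
  -- `j` cannot be in the C₅ part of `b`, since its position there would again be `j`.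
  rim-misses-edge : ∀ {a b m j p} → ¬ C₅.Adj (suc m) j → Gadget.Adj p (inj₂ j) →
                    GAdj (rim b m) (copy a p) → ¬ GAdj (rim b m) (copy a (inj₂ j))
  rim-misses-edge {a} {b} {m} {j} {p} m≁j e gp gj
    with rim-neighbour gp refl | rim-neighbour gj refl
  ... | r , eqp , er | q , eqj , eq = cases j p q r m≁j e eqp er eqj eq
    where
    cases : ∀ j p q r → ¬ C₅.Adj (suc m) j → Gadget.Adj p (inj₂ j) →
            copy a p ≡ copy b r → Gadget.Adj (inj₂ (suc m)) r →
            copy a (inj₂ j) ≡ copy b q → ¬ Gadget.Adj (inj₂ (suc m)) q
    cases (suc j) _ (inj₂ (suc j)) _ m≁j _ _ _ refl eq = m≁j eq
    cases (suc j) _ (inj₁ 0F) _ _ _ _ _ () _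
    cases (suc j) _ (inj₁ 1F) _ _ _ _ _ () _
    cases (suc j) _ (inj₂ 0F) _ _ _ _ _ () _
    cases 0F _ (inj₂ 0F) _ m≁j _ _ _ _ eq = m≁j eq
    cases 0F _ (inj₁ 1F) _ _ _ _ _ () _
    cases 0F _ (inj₂ (suc _)) _ _ _ _ _ () _
    -- What remains is that the tail of `a` is the head of `b`. If the other end is the head of `a`,
    -- it is the head of `b`, making `a` a loop, or the tail of `b`, contradicting `m≁j`. If it is
    -- private, then `a` is `b` and again a loop.
    cases 0F (inj₁ 0F) (inj₁ 0F) (inj₁ 0F) _ _ eqp _ eqj _ =
      tail≢head a (cong (collapse D) (trans eqj (sym eqp)))
    cases 0F (inj₁ 0F) (inj₁ 0F) (inj₂ 0F) m≁j _ _ er _ _ = m≁j er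
    cases 0F (inj₁ 0F) (inj₁ 0F) (inj₁ 1F) _ _ () _ _ _
    cases 0F (inj₁ 0F) (inj₁ 0F) (inj₂ (suc _)) _ _ () _ _ _
    cases 0F (inj₁ 1F) (inj₁ 0F) (inj₁ 1F) _ _ refl _ eqj _ = tail≢head a (cong (collapse D) eqj)
    cases 0F (inj₁ 1F) (inj₁ 0F) (inj₁ 0F) _ _ () _ _ _
    cases 0F (inj₁ 1F) (inj₁ 0F) (inj₂ 0F) _ _ () _ _ _
    cases 0F (inj₁ 1F) (inj₁ 0F) (inj₂ (suc _)) _ _ () _ _ _
    cases 0F (inj₂ 0F) (inj₁ 0F) _ _ e _ _ _ _ = C₅.no-loop {0F} e
    cases 0F (inj₂ (suc _)) (inj₁ 0F) (inj₂ (suc _)) _ _ refl _ eqj _ =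
      tail≢head a (cong (collapse D) eqj)
    cases 0F (inj₂ (suc _)) (inj₁ 0F) (inj₁ 0F) _ _ () _ _ _
    cases 0F (inj₂ (suc _)) (inj₁ 0F) (inj₁ 1F) _ _ () _ _ _
    cases 0F (inj₂ (suc _)) (inj₁ 0F) (inj₂ 0F) _ _ () _ _ _

  -- Homomorphisms from the gadget

  module _ (colouring : Colorable 4 (underlying D)) where
    private
      c = proj₁ colouring

    head≢tail : (a : Arc) → c (Arc.head a) ≢ c (Arc.tail a)
    head≢tail a = proj₂ colouring (inj₂ (Arc.isArc a))

    -- The rim vertices at position `m` also receive a colour, only to make the map total; edges at
    -- them need not be properly coloured.
    puncturedColour : Fin 4 → G.Vertex → Fin 4
    puncturedColour m (base v)  = c v
    puncturedColour m (apex a)  = palette (head≢tail a) (gadgetColour m (inj₁ 1F))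
    puncturedColour m (rim a i) = palette (head≢tail a) (gadgetColour m (inj₂ (suc i)))

    puncturedColour-copy : ∀ m a p →
      puncturedColour m (copy a p) ≡ palette (head≢tail a) (gadgetColour m p)
    puncturedColour-copy m a (inj₁ 0F)      = refl
    puncturedColour-copy m a (inj₁ 1F)      = refl
    puncturedColour-copy m a (inj₂ 0F)      = refl
    puncturedColour-copy m a (inj₂ (suc i)) = refl

    puncturedColour-proper : ∀ m {x y} → GAdj x y →
      (∀ b → x ≢ rim b m) → (∀ b → y ≢ rim b m) →
      puncturedColour m x ≢ puncturedColour m y
    puncturedColour-proper m (edge a {p} {q} e) x≢ y≢ eq =
      gadgetColour-proper m p q e (λ { refl → x≢ a refl }) (λ { refl → y≢ a refl })
        (palette-injective (head≢tail a)
          (trans (sym (puncturedColour-copy m a p)) (trans eq (puncturedColour-copy m a q))))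

    module _ (φ : Gadget.Vertex → G.Vertex) (φ-hom : IsGraphHom Gadget graph φ) where

      K₂-avoids-C₅ : ∀ {k l} a p j → k ≢ l → Gadget.Adj p (inj₂ j) →
                     φ (inj₁ k) ≡ copy a p → φ (inj₁ l) ≢ copy a (inj₂ j)
      K₂-avoids-C₅ {k} {l} a p j k≢l e eqp eqj with C₅-nonneighbour j
      ... | m , m≢j , m≁j = Gadget-not-4-colorable
        ( puncturedColour m ∘ φ
        , λ {x} {y} x~y → puncturedColour-proper m (φ-hom {x} {y} x~y) (missed x) (missed y))
        where
        K₂-vertices : ∀ {k l} (i : Fin 2) → k ≢ l → i ≡ k ⊎ i ≡ l
        K₂-vertices {0F} 0F _ = inj₁ refl
        K₂-vertices {1F} 1F _ = inj₁ refl
        K₂-vertices {0F} {0F} 1F k≢l = contradiction refl k≢l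
        K₂-vertices {0F} {1F} 1F _ = inj₂ refl
        K₂-vertices {1F} {0F} 0F _ = inj₂ refl
        K₂-vertices {1F} {1F} 0F k≢l = contradiction refl k≢l

        missed : ∀ x b → φ x ≢ rim b m
        missed (inj₁ i) b eq with K₂-vertices i k≢l
        ... | inj₁ refl = m≁j (subst (λ r → Gadget.Adj r (inj₂ j))
                                     (copy≡rim p (trans (sym eqp) eq)) e)
        ... | inj₂ refl with copy≡rim (inj₂ j) (trans (sym eqj) eq)
        ...   | refl = m≢j refl
        -- A cycle vertex is joined to both vertices of K₂, so its image is adjacent to both ends of
        -- the edge in copy `a`.
        missed (inj₂ i) b eq = rim-misses-edge {p = p} m≁j e
          (subst₂ GAdj eq eqp (φ-hom {inj₂ i} {inj₁ k} tt))
          (subst₂ GAdj eq eqj (φ-hom {inj₂ i} {inj₁ l} tt))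

      private
        MapsToCopy : Arc → Set
        MapsToCopy a = (∀ k → ∃[ k′ ] φ (inj₁ k) ≡ copy a (inj₁ k′))
                     × (∀ i → ∃[ i′ ] φ (inj₂ i) ≡ copy a (inj₂ i′))

      -- Adjacency to the private apex confines the images to copy `a`; adjacency to the head and to
      -- the apex rules out both of these, since there are no loops.
      C₅-to-C₅ : ∀ {a k l} → φ (inj₁ k) ≡ copy a (inj₁ 0F) → φ (inj₁ l) ≡ copy a (inj₁ 1F) →
                 ∀ i → ∃[ i′ ] φ (inj₂ i) ≡ copy a (inj₂ i′)
      C₅-to-C₅ {a} {k} {l} eqk eql i with apex-neighbour (φ-hom {inj₁ l} {inj₂ i} tt) eql
      ... | inj₁ 0F , eq , _ = contradiction
              (subst₂ GAdj eqk eq (φ-hom {inj₁ k} {inj₂ i} tt)) G.no-loop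
      ... | inj₁ 1F , _ , e = contradiction refl e
      ... | inj₂ i′ , eq , _ = i′ , eq

      maps-to-copy : ∃ MapsToCopy
      maps-to-copy = locate (φ-hom {inj₁ 0F} {inj₁ 1F} λ ()) refl refl
        where
        locate : ∀ {x y} → GAdj x y → φ (inj₁ 0F) ≡ x → φ (inj₁ 1F) ≡ y → ∃ MapsToCopy
        locate (edge a {p} {inj₂ j} e) eqp eqj =
          contradiction eqj (K₂-avoids-C₅ a p j (λ ()) e eqp)
        locate (edge a {inj₂ j} {inj₁ q} e) eqj eqq =
          contradiction eqj (K₂-avoids-C₅ a (inj₁ q) j (λ ()) tt eqq)
        locate (edge a {inj₁ 0F} {inj₁ 0F} e) _ _ = contradiction refl e
        locate (edge a {inj₁ 1F} {inj₁ 1F} e) _ _ = contradiction refl e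
        locate (edge a {inj₁ 0F} {inj₁ 1F} e) eq₀ eq₁ =
          a , (λ { 0F → 0F , eq₀ ; 1F → 1F , eq₁ }) , C₅-to-C₅ {k = 0F} {l = 1F} eq₀ eq₁
        locate (edge a {inj₁ 1F} {inj₁ 0F} e) eq₀ eq₁ =
          a , (λ { 0F → 1F , eq₀ ; 1F → 0F , eq₁ }) , C₅-to-C₅ {k = 1F} {l = 0F} eq₁ eq₀

  collapse-K₂ : ∀ a k → collapse D (copy a (inj₁ k)) ≡ Arc.head a
  collapse-K₂ a 0F = refl
  collapse-K₂ a 1F = refl

  collapse-C₅ : ∀ a i → collapse D (copy a (inj₂ i)) ≡ Arc.tail a
  collapse-C₅ a 0F      = refl
  collapse-C₅ a (suc _) = refl

  -- An apex lies only in a K₂ part and a rim vertex only in a C₅ part, so a vertex in both kinds of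
  -- part is not private.
  K₂∩C₅-is-base : ∀ {x a b} k i → x ≡ copy a (inj₁ k) → x ≡ copy b (inj₂ i) →
                  x ≡ base (collapse D x)
  K₂∩C₅-is-base 0F _       refl _  = refl
  K₂∩C₅-is-base 1F 0F      refl ()
  K₂∩C₅-is-base 1F (suc _) refl ()

-- Passing between digraph and graph homomorphisms

module _ (D₁ D₂ : Digraph) where
  private
    module D₁ = Digraph D₁
    module D₂ = Digraph D₂
    module R₁ = GadgetReplacement D₁
    module R₂ = GadgetReplacement D₂

  lift-hom : DigraphHom D₁ D₂ → GraphHom G[ D₁ ] G[ D₂ ]
  lift-hom (f , f-hom) = F , F-hom
    where
    f-arc : D₁.Arc → D₂.Arc
    f-arc a = D₂.mkArc (f-hom (D₁.Arc.isArc a))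

    F : R₁.GVertex → R₂.GVertex
    F (base v)     = base (f v)
    F (R₁.apex a)  = R₂.apex (f-arc a)
    F (R₁.rim a i) = R₂.rim (f-arc a) i

    F-copy : ∀ a p → R₂.copy (f-arc a) p ≡ F (R₁.copy a p)
    F-copy a (inj₁ 0F)      = refl
    F-copy a (inj₁ 1F)      = refl
    F-copy a (inj₂ 0F)      = refl
    F-copy a (inj₂ (suc _)) = refl

    F-hom : IsGraphHom G[ D₁ ] G[ D₂ ] F
    F-hom (R₁.edge a {p} {q} e) =
      subst₂ R₂.GAdj (F-copy a p) (F-copy a q) (R₂.edge (f-arc a) {p} {q} e)

  module _ (colouring : Colorable 4 (underlying D₂))
           (ψ : R₁.GVertex → R₂.GVertex) (ψ-hom : IsGraphHom G[ D₁ ] G[ D₂ ] ψ) where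

    image-of-copy : ∀ a → ∃[ b ] ((∀ k → ∃[ k′ ] ψ (R₁.copy a (inj₁ k)) ≡ R₂.copy b (inj₁ k′))
                                × (∀ i → ∃[ i′ ] ψ (R₁.copy a (inj₂ i)) ≡ R₂.copy b (inj₂ i′)))
    image-of-copy a = maps-to-copy D₂ colouring (ψ ∘ R₁.copy a)
      λ {p} {q} e → ψ-hom (R₁.edge a {p} {q} e)

    collapse-hom : IsDigraphHom D₁ D₂ (λ v → collapse D₂ (ψ (base v)))
    collapse-hom {u} {v} u⟶v with image-of-copy (D₁.mkArc u⟶v)
    ... | b , K₂-image , C₅-image with K₂-image 0F | C₅-image 0F
    ...   | k , eqv | i , equ = subst₂ D₂._⟶_
            (sym (trans (cong (collapse D₂) equ) (collapse-C₅ D₂ b i)))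
            (sym (trans (cong (collapse D₂) eqv) (collapse-K₂ D₂ b k)))
            (D₂.Arc.isArc b)

    -- Being the head of one arc and the tail of another, `v` has its image in the K₂ part of one
    -- copy and in the C₅ part of some copy.
    base-to-base : ∀ v → D₁.HasInArc v → D₁.HasOutArc v →
                   ψ (base v) ≡ base (collapse D₂ (ψ (base v)))
    base-to-base v (_ , in-arc) (_ , out-arc)
      with image-of-copy (D₁.mkArc in-arc) | image-of-copy (D₁.mkArc out-arc)
    ... | _ , K₂-image , _ | _ , _ , C₅-image with K₂-image 0F | C₅-image 0F
    ...   | k , eqk | i , eqi = K₂∩C₅-is-base D₂ k i eqk eqi

    -- Since `collapse` is the identity on base vertices, `f` agrees with the map of `collapse-hom`.
    restriction-hom : ∀ f → (∀ v → ψ (base v) ≡ base (f v)) → IsDigraphHom D₁ D₂ f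
    restriction-hom f ψ≡f {u} {v} u⟶v =
      subst₂ D₂._⟶_ (cong (collapse D₂) (ψ≡f u)) (cong (collapse D₂) (ψ≡f v)) (collapse-hom u⟶v)

theorem44 : (D₁ D₂ : Digraph) → Colorable 4 (underlying D₂) →
    (DigraphHom D₁ D₂ ⇔ GraphHom G[ D₁ ] G[ D₂ ])
    × (∀ (ψ : Graph.Vertex G[ D₁ ] → Graph.Vertex G[ D₂ ]) → IsGraphHom G[ D₁ ] G[ D₂ ] ψ →
    (∀ (f : Digraph.Vertex D₁ → Digraph.Vertex D₂) →
    (∀ v → ψ (base v) ≡ base (f v)) → IsDigraphHom D₁ D₂ f)
    × (∀ v → Digraph.HasInArc D₁ v → Digraph.HasOutArc D₁ v →
    ψ (base v) ≡ base (collapse D₂ (ψ (base v))))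
    × IsDigraphHom D₁ D₂ (λ v → collapse D₂ (ψ (base v))))
theorem44 D₁ D₂ colouring =
  mk⇔ (lift-hom D₁ D₂)
      (λ (ψ , ψ-hom) → _ , collapse-hom D₁ D₂ colouring ψ ψ-hom) ,
  λ ψ ψ-hom → restriction-hom D₁ D₂ colouring ψ ψ-hom
            , base-to-base D₁ D₂ colouring ψ ψ-hom
            , collapse-hom D₁ D₂ colouring ψ ψ-hom
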